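{- For every integer $\ell \ge 1$, every directed graph $G$ in which every vertex has out-degree at least $2\ell$ contains a $(2,\ell)$-spider as a subgraph.
   Context: A directed graph is finite, has no loops, and may contain both edges $(x,y)$ and $(y,x)$ (but no parallel edges in the same direction). For integers $k \ge 2$, $\ell \ge 1$, a $(k,\ell)$-spider is the oriented graph obtained from the in-star with $\ell$ leaves (a central vertex $r$ with $\ell$ edges oriented from the leaves towards $r$) by subdividing each edge $k-1$ times. Thus a $(2,\ell)$-spider consists of a vertex $r$ together with $\ell$ directed paths $x_i \to y_i \to r$ ($1 \le i \le \ell$) on $2\ell+1$ pairwise distinct vertices $r, x_1,y_1,\dots,x_\ell,y_\ell$. -}

module Defs where

open import Data.Nat using (ℕ; suc; _+_)
open import Data.Bool using (Bool; true; false)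
open import Data.Fin using (Fin)
open import Data.Fin.Subset using (Subset; ∣_∣)
open import Data.Vec using (tabulate)
open import Data.Sum using (_⊎_)
open import Relation.Binary.PropositionalEquality using (_≡_)
open import Relation.Nullary using (¬_)
open import Function.Definitions using (Injective)

-- A directed graph on the vertex set Fin n, given by its adjacency relation:
-- adj x y ≡ true means there is an edge (x , y).  Both (x,y) and (y,x) may be
-- present; parallel edges in the same direction are impossible by construction.
-- Loops are excluded by the field noLoop.
record Digraph (n : ℕ) : Set where
  field
    adj    : Fin n → Fin n → Bool
    noLoop : ∀ x → adj x x ≡ false

open Digraph public

Edge : ∀ {n} → Digraph n → Fin n → Fin n → Set
Edge G x y = adj G x y ≡ true

outNbhd : ∀ {n} → Digraph n → Fin n → Subset n
outNbhd G x = tabulate (adj G x)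

outDeg : ∀ {n} → Digraph n → Fin n → ℕ
outDeg G x = ∣ outNbhd G x ∣

record HasSpider2 {n : ℕ} (G : Digraph n) (ℓ : ℕ) : Set where
  field
    r     : Fin n
    xs ys : Fin ℓ → Fin n
    xs-inj : Injective _≡_ _≡_ xs
    ys-inj : Injective _≡_ _≡_ ys
    xs≢ys  : ∀ i j → ¬ xs i ≡ ys j
    xs≢r   : ∀ i → ¬ xs i ≡ r
    ys≢r   : ∀ i → ¬ ys i ≡ r
    edge-xy : ∀ i → Edge G (xs i) (ys i)
    edge-yr : ∀ i → Edge G (ys i) r

{-# OPTIONS --safe #-}
module Submission where

open import Defs
open import Data.Nat using (ℕ; zero; suc; _+_; _*_; _⊓_; _≤_; _<_; z≤n; s≤s)
open import Data.Nat.Properties hiding (_≟_)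
open import Data.Nat.Tactic.RingSolver using (solve-∀)
open import Data.Bool using (Bool; true; false; _∧_; not; if_then_else_)
import Data.Bool.Properties as Bool
open import Data.Fin using (Fin; zero; suc)
open import Data.Fin.Properties using (_≟_; any?; all?; ¬∀⟶∃¬)
open import Data.Fin.Subset using (∣_∣)
open import Data.List using (List; []; _∷_; _++_; length; map; lookup)
open import Data.List.Properties using (length-++; length-map)
open import Data.List.Membership.Propositional using (_∈_; _∉_; find)
open import Data.List.Membership.Propositional.Properties
  using (∈-map⁺; ∈-map⁻; ∈-++⁺ˡ; ∈-++⁺ʳ; ∈-++⁻; ∈-∃++; ∈-lookup)
open import Data.List.Relation.Binary.Permutation.Propositional
  using (_↭_; prep; ↭-sym; ↭-trans; ↭⇒↭ₛ)
open import Data.List.Relation.Binary.Permutation.Propositional.Properties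
  using (shift; ∈-resp-↭; All-resp-↭; ↭-length; ++⁺; ++⁺ˡ; map⁺)
import Data.List.Relation.Binary.Permutation.Setoid.Properties as ↭ₛ
open import Data.List.Relation.Binary.Subset.Propositional using (_⊆_)
open import Data.List.Relation.Unary.All as All using (All; []; _∷_)
open import Data.List.Relation.Unary.All.Properties using (¬All⇒Any¬; ¬Any⇒All¬; All¬⇒¬Any)
open import Data.List.Relation.Unary.AllPairs using ([]; _∷_)
open import Data.List.Relation.Unary.Any using (here; there)
open import Data.List.Relation.Unary.Unique.Propositional using (Unique)
open import Data.Product using (∃; ∃-syntax; _×_; _,_; proj₁; proj₂)
open import Data.Sum using (_⊎_; inj₁; inj₂)
open import Data.Vec using (tabulate)
open import Function using (_∘_; id; case_of_)
open import Relation.Binary.PropositionalEquality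
open import Relation.Nullary using (Dec; yes; no; ¬_; contradiction; does)
open import Relation.Nullary.Decidable using (map′; _×-dec_; decidable-stable; dec-false)
open import Relation.Unary using (Decidable)
open import Algebra.Properties.CommutativeSemigroup +-commutativeSemigroup using (x∙yz≈y∙xz)
open import Algebra.Properties.Semiring.Sum +-*-semiring
  using (sum; sum-cong-≗; ∑-distrib-+; ∑-comm; *-distribˡ-sum; *-distribʳ-sum; sum-replicate-zero)

-- Thin the graph so that every out-degree is d = 2ℓ, and give a vertex y the weight
-- f(y) = min(d, indeg y).  Summing over all edges y → r, Σ_r Σ_{y → r} f(y) = d Σ_r f(r), so it is
-- contradictory that Σ_{y → r} f(y) ≤ d f(r) for every r, strictly when indeg r ≥ d (such r exists
-- by averaging).  For indeg r ≤ d the bound is clear from f ≤ d.  If indeg r ≥ d and r is the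
-- centre of no spider, then the graph F of edges x → y with x ≠ r and y → r has no matching of
-- size ℓ = k + 1, which forces Σ_y min(d, indeg_F y) ≤ 2kd; the edges leaving r add at most d, and
-- d + 2kd < d² = d f(r).  The bound on F is by induction on k.  If deleting some vertex v lowers
-- the matching number, then v accounts for at most d as a head and d as a tail.  Otherwise every
-- vertex is missed by a maximum matching, and then, as in Gallai's lemma, a maximum matching M
-- never misses two neighbours of one vertex; since M covers 2k vertices and every edge meets one
-- of them, there are at most (2k)² + 2k + 2k ≤ 2kd edges.

-- Lists without repetition, permutations, exhaustive search.

module _ {a} {A : Set a} where

  Unique-resp-↭ : {xs ys : List A} → xs ↭ ys → Unique xs → Unique ys
  Unique-resp-↭ p = ↭ₛ.Unique-resp-↭ (setoid A) (↭⇒↭ₛ p)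

  ∈⇒↭∷ : {x : A} {xs : List A} → x ∈ xs → ∃[ ys ] xs ↭ x ∷ ys
  ∈⇒↭∷ x∈xs with as , bs , refl ← ∈-∃++ x∈xs = as ++ bs , shift _ as bs

  Unique-⊆⇒length≤ : {xs ys : List A} → Unique xs → xs ⊆ ys → length xs ≤ length ys
  Unique-⊆⇒length≤ {[]} _ _ = z≤n
  Unique-⊆⇒length≤ {x ∷ xs} {ys} (x≢xs ∷ xs!) xs⊆ys with zs , p ← ∈⇒↭∷ (xs⊆ys (here refl)) =
    ≤-trans (s≤s (Unique-⊆⇒length≤ xs! xs⊆zs)) (≤-reflexive (sym (↭-length p)))
    where
    xs⊆zs : xs ⊆ zs
    xs⊆zs v∈xs with ∈-resp-↭ p (xs⊆ys (there v∈xs))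
    ... | here refl  = contradiction refl (All.lookup x≢xs v∈xs)
    ... | there v∈zs = v∈zs

  -- Vertices range over a finite set, so this decides whether a matching of given size exists; the
  -- case distinctions of the proof rest on that.
  ∃-ofLength? : (∀ {p} {P : A → Set p} → Decidable P → Dec (∃ P)) →
    ∀ {p} {P : List A → Set p} → Decidable P → ∀ k → Dec (∃[ xs ] length xs ≡ k × P xs)
  ∃-ofLength? search P? zero = map′ (λ p → [] , refl , p) (λ { ([] , _ , p) → p }) (P? [])
  ∃-ofLength? search P? (suc k) =
    map′ (λ { (x , xs , refl , p) → x ∷ xs , refl , p })
         (λ { (x ∷ xs , refl , p) → x , xs , refl , p })
         (search λ x → ∃-ofLength? search (λ xs → P? (x ∷ xs)) k)

-- Matchings and the exchange argument behind Gallai's lemma.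

module _ {n : ℕ} where

  open import Data.List.Membership.DecPropositional (_≟_ {n}) using (_∈?_)
  open import Data.List.Relation.Unary.Unique.DecPropositional (_≟_ {n}) using (unique?)

  ends : List (Fin n × Fin n) → List (Fin n)
  ends M = map proj₁ M ++ map proj₂ M

  EndOf : Fin n → Fin n × Fin n → Set
  EndOf v e = v ≡ proj₁ e ⊎ v ≡ proj₂ e

  ends-↭ : ∀ {M N} → M ↭ N → ends M ↭ ends N
  ends-↭ p = ++⁺ (map⁺ proj₁ p) (map⁺ proj₂ p)

  ends-∷ : ∀ e M → ends (e ∷ M) ↭ proj₁ e ∷ proj₂ e ∷ ends M
  ends-∷ e M = prep _ (shift (proj₂ e) (map proj₁ M) (map proj₂ M))

  length-ends : ∀ M → length (ends M) ≡ length M + length M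
  length-ends M = trans (length-++ (map proj₁ M)) (cong₂ _+_ (length-map proj₁ M) (length-map proj₂ M))

  ∈-ends⁺ : ∀ {v e M} → e ∈ M → EndOf v e → v ∈ ends M
  ∈-ends⁺ e∈M (inj₁ refl) = ∈-++⁺ˡ (∈-map⁺ proj₁ e∈M)
  ∈-ends⁺ e∈M (inj₂ refl) = ∈-++⁺ʳ _ (∈-map⁺ proj₂ e∈M)

  ∈-ends⁻ : ∀ {v} M → v ∈ ends M → ∃[ e ] e ∈ M × EndOf v e
  ∈-ends⁻ M v∈ with ∈-++⁻ (map proj₁ M) v∈
  ... | inj₁ v∈₁ with e , e∈M , eq ← ∈-map⁻ proj₁ v∈₁ = e , e∈M , inj₁ eq
  ... | inj₂ v∈₂ with e , e∈M , eq ← ∈-map⁻ proj₂ v∈₂ = e , e∈M , inj₂ eq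

  -- Lets the exchange argument treat both orientations of an edge alike.
  otherEnd : ∀ {z e} → EndOf z e → ∃[ w ] EndOf w e × (∀ {v} → EndOf v e → v ≡ z ⊎ v ≡ w)
  otherEnd {e = a , b} (inj₁ refl) = b , inj₂ refl , id
  otherEnd {e = a , b} (inj₂ refl) = a , inj₁ refl , λ { (inj₁ p) → inj₂ p ; (inj₂ p) → inj₁ p }

  Unique-ends-∷⁺ : ∀ {e M} → proj₁ e ≢ proj₂ e → (∀ {v} → EndOf v e → v ∉ ends M) →
    Unique (ends M) → Unique (ends (e ∷ M))
  Unique-ends-∷⁺ {e} {M} a≢b fresh M! = Unique-resp-↭ (↭-sym (ends-∷ e M))
    ((a≢b ∷ ¬Any⇒All¬ _ (fresh (inj₁ refl))) ∷ ¬Any⇒All¬ _ (fresh (inj₂ refl)) ∷ M!)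

  Unique-ends-∷⁻ : ∀ {e M} → Unique (ends (e ∷ M)) →
    proj₁ e ≢ proj₂ e × (∀ {v} → EndOf v e → v ∉ ends M) × Unique (ends M)
  Unique-ends-∷⁻ {e} {M} eM! with Unique-resp-↭ (ends-∷ e M) eM!
  ... | (a≢b ∷ a∉) ∷ b∉ ∷ M! =
    a≢b , (λ { (inj₁ refl) → All¬⇒¬Any a∉ ; (inj₂ refl) → All¬⇒¬Any b∉ }) , M!

  ends-⊆-∷ : ∀ {e M} → ends M ⊆ ends (e ∷ M)
  ends-⊆-∷ {M = M} v∈ with e , e∈M , v∈e ← ∈-ends⁻ M v∈ = ∈-ends⁺ (there e∈M) v∈e

  lookup-ends-disjoint : ∀ {v} M → Unique (ends M) → ∀ i j →
    EndOf v (lookup M i) → EndOf v (lookup M j) → i ≡ j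
  lookup-ends-disjoint (e ∷ M) eM! i j v∈i v∈j with _ , fresh , M! ← Unique-ends-∷⁻ {e} eM! = go i j v∈i v∈j
    where
    go : ∀ i j → EndOf _ (lookup (e ∷ M) i) → EndOf _ (lookup (e ∷ M) j) → i ≡ j
    go zero    zero    _   _   = refl
    go zero    (suc j) v∈i v∈j = contradiction (∈-ends⁺ {M = M} (∈-lookup j) v∈j) (fresh v∈i)
    go (suc i) zero    v∈i v∈j = contradiction (∈-ends⁺ {M = M} (∈-lookup i) v∈i) (fresh v∈j)
    go (suc i) (suc j) v∈i v∈j = cong suc (lookup-ends-disjoint M M! i j v∈i v∈j)

  module _ (E : Fin n → Fin n → Bool) where

    -- A matching of the underlying undirected graph, stored with orientations: `Unique (ends M)`
    -- forbids loops and makes distinct edges disjoint, whatever their directions.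
    IsMatching : List (Fin n × Fin n) → Set
    IsMatching M = All (λ e → E (proj₁ e) (proj₂ e) ≡ true) M × Unique (ends M)

    HasMatching : ℕ → Set
    HasMatching k = ∃[ M ] length M ≡ k × IsMatching M

    hasMatching? : ∀ k → Dec (HasMatching k)
    hasMatching? = ∃-ofLength?
      (λ P? → map′ (λ { (x , y , p) → (x , y) , p }) (λ { ((x , y) , p) → x , y , p })
                   (any? λ x → any? λ y → P? (x , y)))
      (λ M → All.all? (λ e → E (proj₁ e) (proj₂ e) Bool.≟ true) M ×-dec unique? (ends M))

    IsMatching-↭ : ∀ {M N} → M ↭ N → IsMatching M → IsMatching N
    IsMatching-↭ p (M⊆E , M!) = All-resp-↭ p M⊆E , Unique-resp-↭ (ends-↭ p) M!

    Adjacent : Fin n → Fin n → Set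
    Adjacent x y = E x y ≡ true ⊎ E y x ≡ true

    module _ (loopless : ∀ x → E x x ≡ false) {k : ℕ} (maximal : ¬ HasMatching (suc k)) where

      -- If `M` missed both ends, adding the edge in whichever direction it exists would give a
      -- matching of size `suc k`.
      adjacent⇒covered : ∀ {x y M} → IsMatching M → length M ≡ k → Adjacent x y →
        y ∉ ends M → x ∈ ends M
      adjacent⇒covered {x} {y} {M} (M⊆E , M!) |M|≡k adj y∉M =
        decidable-stable (x ∈? ends M) λ x∉M → case adj of λ where
          (inj₁ xy) → maximal ((x , y) ∷ M , cong suc |M|≡k , xy ∷ M⊆E ,
            Unique-ends-∷⁺ (irreflexive xy) (λ { (inj₁ refl) → x∉M ; (inj₂ refl) → y∉M }) M!)
          (inj₂ yx) → maximal ((y , x) ∷ M , cong suc |M|≡k , yx ∷ M⊆E ,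
            Unique-ends-∷⁺ (irreflexive yx) (λ { (inj₁ refl) → y∉M ; (inj₂ refl) → x∉M }) M!)
        where
        irreflexive : ∀ {x y} → E x y ≡ true → x ≢ y
        irreflexive xx refl with () ← trans (sym xx) (loopless _)

      module _ {x x′ y : Fin n} (x≢x′ : x ≢ x′) (xy : Adjacent x y) (x′y : Adjacent x′ y) where

        -- N covers x and x′, so if M does not and |M| = |N|, then M covers some z ≢ y that N
        -- misses; the edge e of M at z can replace the edge f of N that meets e, which enlarges
        -- the common part K and keeps y uncovered by N.
        exchange : ∀ m K M N → length M ≡ m →
          IsMatching (K ++ M) → IsMatching (K ++ N) →
          length (K ++ M) ≡ k → length (K ++ N) ≡ k →
          ¬ (x ∉ ends (K ++ M) × x′ ∉ ends (K ++ M) × y ∉ ends (K ++ N))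
        exchange m K M N |M| KM KN |KM| |KN| (x∉ , x′∉ , y∉)
          with All.all? (λ z → z ∈? (y ∷ ends (K ++ N))) (ends (K ++ M))
        -- The vertices `x`, `x′` and the 2k ends of `K ++ M` are distinct, whereas
        -- `y ∷ ends (K ++ N)` has only 2k + 1 entries.
        ... | yes KM⊆ = contradiction
            (Unique-⊆⇒length≤
              {ys = y ∷ ends (K ++ N)}
              ((x≢x′ ∷ ¬Any⇒All¬ _ x∉) ∷ ¬Any⇒All¬ _ x′∉ ∷ proj₂ KM)
              λ { (here refl) → there (adjacent⇒covered KN |KN| xy y∉)
                ; (there (here refl)) → there (adjacent⇒covered KN |KN| x′y y∉)
                ; (there (there v∈)) → All.lookup KM⊆ v∈ })
            (<⇒≱ (s≤s (s≤s (≤-reflexive |ends|≡))))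
          where
          |ends|≡ : length (ends (K ++ N)) ≡ length (ends (K ++ M))
          |ends|≡ = trans (length-ends (K ++ N))
            (trans (cong (λ l → l + l) (trans |KN| (sym |KM|))) (sym (length-ends (K ++ M))))
        ... | no ¬KM⊆
          with z , z∈ , z∉ ← find (¬All⇒Any¬ (λ z → z ∈? (y ∷ ends (K ++ N))) _ ¬KM⊆)
          with e , e∈ , z∈e ← ∈-ends⁻ (K ++ M) z∈
          with ∈-++⁻ K e∈
        -- An edge of the common part `K` has its ends covered by `K ++ N` too.
        ... | inj₁ e∈K = z∉ (there (∈-ends⁺ (∈-++⁺ˡ e∈K) z∈e))
        ... | inj₂ e∈M
          with M′ , M↭ ← ∈⇒↭∷ e∈M
          with w , w∈e , e-ends ← otherEnd {e = e} z∈e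
          with e∷KM ← IsMatching-↭ (↭-trans (++⁺ˡ K M↭) (shift e K M′)) KM
          with a≢b , e-fresh , _ ← Unique-ends-∷⁻ {e} (proj₂ e∷KM)
          with w ∈? ends (K ++ N)
        -- `K ++ N` misses both ends of `e`, so `e` would enlarge it.
        ... | no w∉ = maximal (e ∷ K ++ N , cong suc |KN| , All.head (proj₁ e∷KM) ∷ proj₁ KN ,
                Unique-ends-∷⁺ a≢b (λ v∈e → case e-ends v∈e of λ { (inj₁ refl) → z∉ ∘ there ; (inj₂ refl) → w∉ })
                  (proj₂ KN))
        ... | yes w∈
          with f , f∈ , w∈f ← ∈-ends⁻ (K ++ N) w∈
          with ∈-++⁻ K f∈
        -- Both `e` and `f` would lie in the matching `K ++ M`, so they cannot share `w`.
        ... | inj₁ f∈K = e-fresh w∈e (∈-ends⁺ (∈-++⁺ˡ f∈K) w∈f)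
        ... | inj₂ f∈N
          with N′ , N↭ ← ∈⇒↭∷ f∈N
          with KN↭ ← ↭-trans (++⁺ˡ K N↭) (shift f K N′)
          with f∷KN ← IsMatching-↭ KN↭ KN
          with _ , f-fresh , KN′! ← Unique-ends-∷⁻ {f} (proj₂ f∷KN)
          -- `m` is the length of `M`, which drops by one as `e` moves into `K`; it makes the
          -- recursion structural.
          with m
        ... | zero with () ← trans (sym |M|) (↭-length M↭)
        ... | suc m = exchange m (e ∷ K) M′ N′
            (suc-injective (trans (sym (↭-length M↭)) |M|))
            e∷KM
            (All.head (proj₁ e∷KM) ∷ All.tail (proj₁ f∷KN) , Unique-ends-∷⁺ a≢b
              -- `z` was missed before, and `w` is freed by removing `f`, the only edge of `K ++ N`
              -- at `w`.
              (λ v∈e → case e-ends v∈e of λ { (inj₁ refl) → z∉ ∘ there ∘ KN′⊆ ; (inj₂ refl) → f-fresh w∈f })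
              KN′!)
            (trans (sym (↭-length KM↭)) |KM|)
            (trans (sym (↭-length KN↭)) |KN|)
            ( x∉ ∘ ∈-resp-↭ (↭-sym (ends-↭ KM↭))
            , x′∉ ∘ ∈-resp-↭ (↭-sym (ends-↭ KM↭))
            -- The new edge `e` does not cover `y`: `z` was chosen different from `y`, and `w` is
            -- covered by `K ++ N` while `y` is not.
            , λ y∈ → case ∈-ends⁻ (e ∷ K ++ N′) y∈ of λ where
                (_ , here refl , y∈e) → case e-ends y∈e of λ where
                  (inj₁ refl) → z∉ (here refl)
                  (inj₂ refl) → y∉ w∈
                (_ , there g∈ , y∈g) → y∉ (KN′⊆ (∈-ends⁺ g∈ y∈g)))
          where
          KM↭ = ↭-trans (++⁺ˡ K M↭) (shift e K M′)
          KN′⊆ : ends (K ++ N′) ⊆ ends (K ++ N)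
          KN′⊆ = ∈-resp-↭ (↭-sym (ends-↭ KN↭)) ∘ ends-⊆-∷ {f}

-- Indicator functions and finite sums.

⟦_⟧ : Bool → ℕ
⟦ b ⟧ = if b then 1 else 0

⟦⟧≤1 : ∀ b → ⟦ b ⟧ ≤ 1
⟦⟧≤1 true  = ≤-refl
⟦⟧≤1 false = z≤n

∣tabulate∣≡sum : ∀ {n} (p : Fin n → Bool) → ∣ tabulate p ∣ ≡ sum (⟦_⟧ ∘ p)
∣tabulate∣≡sum {zero}  p = refl
∣tabulate∣≡sum {suc n} p with p zero
... | true  = cong suc (∣tabulate∣≡sum (p ∘ suc))
... | false = ∣tabulate∣≡sum (p ∘ suc)

sum-mono-≤ : ∀ {n} {f g : Fin n → ℕ} → (∀ i → f i ≤ g i) → sum f ≤ sum g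
sum-mono-≤ {zero}  f≤g = z≤n
sum-mono-≤ {suc n} f≤g = +-mono-≤ (f≤g zero) (sum-mono-≤ (f≤g ∘ suc))

sum-mono-< : ∀ {n} {f g : Fin n → ℕ} → (∀ i → f i ≤ g i) → ∀ j → f j < g j → sum f < sum g
sum-mono-< f≤g zero    lt = +-mono-<-≤ lt (sum-mono-≤ (f≤g ∘ suc))
sum-mono-< f≤g (suc j) lt = +-mono-≤-< (f≤g zero) (sum-mono-< (f≤g ∘ suc) j lt)

sum-≤-except : ∀ {n} {f g : Fin n → ℕ} v → (∀ i → i ≢ v → f i ≤ g i) → sum f ≤ f v + sum g
sum-≤-except {f = f} {g} zero f≤g = +-monoʳ-≤ (f zero)
  (≤-trans (sum-mono-≤ (λ i → f≤g (suc i) λ ())) (m≤n+m _ (g zero)))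
sum-≤-except {f = f} {g} (suc v) f≤g = begin
  f zero + sum (f ∘ suc)
    ≤⟨ +-mono-≤ (f≤g zero λ ()) (sum-≤-except v λ i i≢v → f≤g (suc i) λ { refl → i≢v refl }) ⟩
  g zero + (f (suc v) + sum (g ∘ suc))
    ≡⟨ x∙yz≈y∙xz (g zero) (f (suc v)) _ ⟩
  f (suc v) + (g zero + sum (g ∘ suc)) ∎
  where open ≤-Reasoning

sum-⟦⟧≤1 : ∀ {n} (p : Fin n → Bool) → (∀ i j → p i ≡ true → p j ≡ true → i ≡ j) → sum (⟦_⟧ ∘ p) ≤ 1
sum-⟦⟧≤1 {n} p unique with any? (λ v → p v Bool.≟ true)
... | yes (v , pv) = begin
  sum (⟦_⟧ ∘ p)                    ≤⟨ sum-≤-except v (λ i i≢v → others i i≢v (p i) refl) ⟩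
  ⟦ p v ⟧ + sum {n} (λ _ → 0)      ≡⟨ cong (⟦ p v ⟧ +_) (sum-replicate-zero n) ⟩
  ⟦ p v ⟧ + 0                      ≡⟨ +-identityʳ _ ⟩
  ⟦ p v ⟧                          ≤⟨ ⟦⟧≤1 (p v) ⟩
  1                                ∎
  where
  open ≤-Reasoning
  others : ∀ i → i ≢ v → ∀ b → p i ≡ b → ⟦ b ⟧ ≤ 0
  others i i≢v true  pi = contradiction (unique i v pi pv) i≢v
  others i i≢v false _  = z≤n
... | no ¬p = ≤-trans (sum-mono-≤ λ i → ≤-reflexive (cong ⟦_⟧ (Bool.¬-not λ pi → ¬p (i , pi))))
    (≤-trans (≤-reflexive (sum-replicate-zero n)) z≤n)

-- With all out-degrees equal to `d`, the weighted double count of edges becomes an equation; the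
-- subset is taken greedily.
∃-trim : ∀ {n} d (p : Fin n → Bool) → d ≤ sum (⟦_⟧ ∘ p) →
  ∃[ q ] (∀ i → q i ≡ true → p i ≡ true) × sum (⟦_⟧ ∘ q) ≡ d
∃-trim {n} zero p _ = (λ _ → false) , (λ _ ()) , sum-replicate-zero n
∃-trim {suc n} (suc d) p d≤ with p zero in eq
... | false with q , q⇒p , |q| ← ∃-trim (suc d) (p ∘ suc) d≤ =
  (λ { zero → false ; (suc i) → q i }) , (λ { (suc i) → q⇒p i }) , |q|
... | true with q , q⇒p , |q| ← ∃-trim d (p ∘ suc) (≤-pred d≤) =
  (λ { zero → true ; (suc i) → q i }) , (λ { zero _ → eq ; (suc i) → q⇒p i }) , cong suc |q|

⟦⟧-mono : ∀ {b c} → (b ≡ true → c ≡ true) → ⟦ b ⟧ ≤ ⟦ c ⟧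
⟦⟧-mono {false} _   = z≤n
⟦⟧-mono {true}  b⇒c = ≤-reflexive (cong ⟦_⟧ (sym (b⇒c refl)))

-- Degrees, capped in-degrees and deletion of a vertex.

module _ {n : ℕ} where

  open import Data.List.Membership.DecPropositional (_≟_ {n}) using (_∈?_)

  sum-∈?≤length : ∀ L → sum (λ v → ⟦ does (v ∈? L) ⟧) ≤ length L
  sum-∈?≤length [] = ≤-reflexive (sum-replicate-zero n)
  sum-∈?≤length (x ∷ L) = ≤-trans (sum-≤-except x off-x)
    (+-mono-≤ (⟦⟧≤1 (does (x ∈? (x ∷ L)))) (sum-∈?≤length L))
    where
    off-x : ∀ v → v ≢ x → ⟦ does (v ∈? (x ∷ L)) ⟧ ≤ ⟦ does (v ∈? L) ⟧
    off-x v v≢x rewrite dec-false (v ≟ x) v≢x = ≤-refl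

  inDegree outDegree : (Fin n → Fin n → Bool) → Fin n → ℕ
  inDegree  E y = sum (λ x → ⟦ E x y ⟧)
  outDegree E x = sum (λ y → ⟦ E x y ⟧)

  cappedInDegree : ℕ → (Fin n → Fin n → Bool) → Fin n → ℕ
  cappedInDegree d E y = d ⊓ inDegree E y

  -- Ignoring the tail `v` lowers the in-degree of `y` by at most `⟦ E v y ⟧`, and `+` distributes
  -- over `⊓`, so the cap does no harm. Serves both for a deleted vertex and for the centre of a
  -- spider.
  cappedInDegree-≤-except : ∀ d E F y v → (∀ x → x ≢ v → E x y ≡ true → F x y ≡ true) →
    cappedInDegree d E y ≤ ⟦ E v y ⟧ + cappedInDegree d F y
  cappedInDegree-≤-except d E F y v E⇒F = begin
    d ⊓ inDegree E y                             ≤⟨ ⊓-mono-≤ (m≤n+m d ⟦ E v y ⟧)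
                                                      (sum-≤-except v λ x x≢v → ⟦⟧-mono (E⇒F x x≢v)) ⟩
    (⟦ E v y ⟧ + d) ⊓ (⟦ E v y ⟧ + inDegree F y) ≡⟨ +-distribˡ-⊓ ⟦ E v y ⟧ d (inDegree F y) ⟨
    ⟦ E v y ⟧ + d ⊓ inDegree F y                 ∎
    where open ≤-Reasoning

  outDegree-mono : ∀ E F x → (∀ y → E x y ≡ true → F x y ≡ true) → outDegree E x ≤ outDegree F x
  outDegree-mono E F x E⇒F = sum-mono-≤ λ y → ⟦⟧-mono (E⇒F y)

  -- The vertex stays in `Fin n` but becomes isolated, so the induction never changes the vertex
  -- type.
  delete : Fin n → (Fin n → Fin n → Bool) → Fin n → Fin n → Bool
  delete v E x y = not (does (x ≟ v)) ∧ not (does (y ≟ v)) ∧ E x y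

  delete⁻ : ∀ v E x y → delete v E x y ≡ true → x ≢ v × y ≢ v × E x y ≡ true
  delete⁻ v E x y exy with x ≟ v | y ≟ v | exy
  ... | no x≢v | no y≢v | exy = x≢v , y≢v , exy
  ... | no _   | yes _  | ()
  ... | yes _  | _      | ()

  delete⁺ : ∀ v E x y → x ≢ v → y ≢ v → E x y ≡ true → delete v E x y ≡ true
  delete⁺ v E x y x≢v y≢v exy rewrite dec-false (x ≟ v) x≢v | dec-false (y ≟ v) y≢v = exy

  delete-loopless : ∀ v E → (∀ x → E x x ≡ false) → ∀ x → delete v E x x ≡ false
  delete-loopless v E loopless x = Bool.¬-not λ xx →
    case trans (sym (proj₂ (proj₂ (delete⁻ v E x x xx)))) (loopless x) of λ ()

  delete-matching : ∀ {v} E {M} → IsMatching (delete v E) M → IsMatching E M × v ∉ ends M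
  delete-matching {v} E {M} (M⊆ , M!) =
    (All.map (proj₂ ∘ proj₂ ∘ delete⁻ v E _ _) M⊆ , M!) ,
    λ v∈ → case ∈-ends⁻ M v∈ of λ where
      (e , e∈M , inj₁ refl) → proj₁ (delete⁻ v E _ _ (All.lookup M⊆ e∈M)) refl
      (e , e∈M , inj₂ refl) → proj₁ (proj₂ (delete⁻ v E (proj₁ e) (proj₂ e) (All.lookup M⊆ e∈M))) refl

-- Graphs without a large matching.

-- With `c` the indicator of the covered vertices, the three terms stand for pairs inside the
-- covered set, edges leaving it and edges entering it.
sum-split : ∀ {n} (c : Fin n → ℕ) (p q : Fin n → Fin n → ℕ) →
  sum (λ y → sum (λ x → c x * c y + (c x * p x y + c y * q x y)))
  ≡ sum c * sum c + (sum (λ x → c x * sum (p x)) + sum (λ y → c y * sum (λ x → q x y)))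
sum-split c p q = begin
  sum (λ y → sum (λ x → c x * c y + (c x * p x y + c y * q x y)))
    ≡⟨ sum-cong-≗ (λ y → begin
      sum (λ x → c x * c y + (c x * p x y + c y * q x y))
        ≡⟨ ∑-distrib-+ (λ x → c x * c y) (λ x → c x * p x y + c y * q x y) ⟩
      sum (λ x → c x * c y) + sum (λ x → c x * p x y + c y * q x y)
        ≡⟨ cong₂ _+_ (sym (*-distribʳ-sum (c y) c)) (∑-distrib-+ (λ x → c x * p x y) (λ x → c y * q x y)) ⟩
      sum c * c y + (sum (λ x → c x * p x y) + sum (λ x → c y * q x y))
        ≡⟨ cong (λ s → sum c * c y + (sum (λ x → c x * p x y) + s)) (sym (*-distribˡ-sum (c y) (λ x → q x y))) ⟩
      sum c * c y + (sum (λ x → c x * p x y) + c y * sum (λ x → q x y)) ∎) ⟩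
  sum (λ y → sum c * c y + (sum (λ x → c x * p x y) + c y * sum (λ x → q x y)))
    ≡⟨ ∑-distrib-+ (λ y → sum c * c y) (λ y → sum (λ x → c x * p x y) + c y * sum (λ x → q x y)) ⟩
  sum (λ y → sum c * c y) + sum (λ y → sum (λ x → c x * p x y) + c y * sum (λ x → q x y))
    ≡⟨ cong₂ _+_ (sym (*-distribˡ-sum (sum c) c))
         (∑-distrib-+ (λ y → sum (λ x → c x * p x y)) (λ y → c y * sum (λ x → q x y))) ⟩
  sum c * sum c + (sum (λ y → sum (λ x → c x * p x y)) + sum (λ y → c y * sum (λ x → q x y)))
    ≡⟨ cong (λ s → sum c * sum c + (s + sum (λ y → c y * sum (λ x → q x y))))
         (trans (∑-comm (λ y x → c x * p x y)) (sum-cong-≗ λ x → sym (*-distribˡ-sum (c x) (p x)))) ⟩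
  sum c * sum c + (sum (λ x → c x * sum (p x)) + sum (λ y → c y * sum (λ x → q x y))) ∎
  where open ≡-Reasoning

-- Each covered vertex sends at most one edge to the vertices that `M` misses and receives at most
-- one from them, hence the summand `2`; the summand `2 * k` beside it counts heads in the covered
-- set.
sum-inDegree-bound : ∀ {n} → Fin n → (E : Fin n → Fin n → Bool) → (∀ x → E x x ≡ false) →
  ∀ {k} → ¬ HasMatching E (suc k) → (∀ v → HasMatching (delete v E) k) →
  sum (inDegree E) ≤ 2 * k * (2 * k + 2)
sum-inDegree-bound {n} v₀ E loopless {k} maximal avoid
  -- Any matching from `avoid` is maximum, by `maximal`; `v₀` is there to name one.
  with M , |M| , M-del ← avoid v₀
  with M-match , _ ← delete-matching E M-del = begin
    sum (λ y → sum (λ x → ⟦ E x y ⟧))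
      ≤⟨ sum-mono-≤ (λ y → sum-mono-≤ (λ x → split x y)) ⟩
    sum (λ y → sum (λ x → c x * c y + (c x * ⟦ fromCovered x y ⟧ + c y * ⟦ toCovered x y ⟧)))
      ≡⟨ sum-split c (λ x y → ⟦ fromCovered x y ⟧) (λ x y → ⟦ toCovered x y ⟧) ⟩
    sum c * sum c + (sum (λ x → c x * sum (λ y → ⟦ fromCovered x y ⟧))
                     + sum (λ y → c y * sum (λ x → ⟦ toCovered x y ⟧)))
      ≤⟨ +-monoʳ-≤ (sum c * sum c) (+-mono-≤
           (sum-*1 (λ x → sum (λ y → ⟦ fromCovered x y ⟧))
             λ x → sum-⟦⟧≤1 (fromCovered x) (fromCovered-unique x))
           (sum-*1 (λ y → sum (λ x → ⟦ toCovered x y ⟧))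
             λ y → sum-⟦⟧≤1 (λ x → toCovered x y) (toCovered-unique y))) ⟩
    sum c * sum c + (sum c + sum c)
      ≡⟨ factor (sum c) ⟩
    sum c * (sum c + 2)
      ≤⟨ *-mono-≤ |c|≤ (+-monoˡ-≤ 2 |c|≤) ⟩
    2 * k * (2 * k + 2) ∎
    where
    open ≤-Reasoning
    open import Data.List.Membership.DecPropositional (_≟_ {n}) using (_∈?_)

    covered : Fin n → Bool
    covered v = does (v ∈? ends M)

    c : Fin n → ℕ
    c v = ⟦ covered v ⟧

    -- That the other end is covered is left to the factors `c x` and `c y` in `split`.
    fromCovered toCovered : Fin n → Fin n → Bool
    fromCovered x y = not (covered y) ∧ E x y
    toCovered   x y = not (covered x) ∧ E x y

    sum-*1 : (f : Fin n → ℕ) → (∀ x → f x ≤ 1) → sum (λ x → c x * f x) ≤ sum c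
    sum-*1 f f≤1 = sum-mono-≤ λ x → ≤-trans (*-monoʳ-≤ (c x) (f≤1 x)) (≤-reflexive (*-identityʳ (c x)))

    factor : ∀ a → a * a + (a + a) ≡ a * (a + 2)
    factor = solve-∀

    |c|≤ : sum c ≤ 2 * k
    |c|≤ = ≤-trans (sum-∈?≤length (ends M)) (≤-reflexive
      (trans (length-ends M) (cong₂ _+_ |M| (trans |M| (sym (+-identityʳ k))))))

    split : ∀ x y → ⟦ E x y ⟧ ≤ c x * c y + (c x * ⟦ fromCovered x y ⟧ + c y * ⟦ toCovered x y ⟧)
    split x y with E x y in xy
    ... | false = z≤n
    ... | true with x ∈? ends M | y ∈? ends M
    ...   | yes _ | yes _ = s≤s z≤n
    ...   | yes _ | no _  = s≤s z≤n
    ...   | no _  | yes _ = s≤s z≤n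
    ...   | no x∉ | no y∉ = contradiction (adjacent⇒covered E loopless maximal M-match |M| (inj₁ xy) y∉) x∉

    missed : ∀ v {b} → not (covered v) ∧ b ≡ true → v ∉ ends M × b ≡ true
    missed v p with v ∈? ends M | p
    ... | no v∉ | p  = v∉ , p
    ... | yes _ | ()

    -- Some maximum matching `N` misses `y`, so `exchange`, started with empty common part, forbids
    -- that `M` misses two neighbours of `y`.
    unique-missed-neighbour : ∀ {x x′ y} → Adjacent E x y → Adjacent E x′ y →
      x ∉ ends M → x′ ∉ ends M → x ≡ x′
    unique-missed-neighbour {x} {x′} {y} xy x′y x∉ x′∉ with x ≟ x′
    ... | yes x≡x′ = x≡x′
    ... | no x≢x′
      with N , |N| , N-del ← avoid y
      with N-match , y∉ ← delete-matching E N-del =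
      contradiction (x∉ , x′∉ , y∉)
        (exchange E loopless maximal x≢x′ xy x′y _ [] M N refl M-match N-match |M| |N|)

    fromCovered-unique : ∀ x y y′ → fromCovered x y ≡ true → fromCovered x y′ ≡ true → y ≡ y′
    fromCovered-unique x y y′ p p′ with y∉ , xy ← missed y p | y′∉ , xy′ ← missed y′ p′ =
      unique-missed-neighbour (inj₂ xy) (inj₂ xy′) y∉ y′∉

    toCovered-unique : ∀ y x x′ → toCovered x y ≡ true → toCovered x′ y ≡ true → x ≡ x′
    toCovered-unique y x x′ p p′ with x∉ , xy ← missed x p | x′∉ , x′y ← missed x′ p′ =
      unique-missed-neighbour (inj₁ xy) (inj₁ x′y) x∉ x′∉

-- The cap keeps a vertex of huge in-degree, which a matching uses at most once, from costing more
-- than `d`. The condition `2 * k + 2 ≤ d` turns the quadratic edge count into `2 * k * d`.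
sum-cappedInDegree-bound : ∀ {n d} → Fin n → ∀ k (E : Fin n → Fin n → Bool) → (∀ x → E x x ≡ false) →
  (∀ x → outDegree E x ≤ d) → 2 * k + 2 ≤ d → ¬ HasMatching E (suc k) →
  sum (cappedInDegree d E) ≤ 2 * k * d
sum-cappedInDegree-bound {n} {d} v₀ k E loopless out≤d k<d maximal
  with all? (λ v → hasMatching? (delete v E) k)
sum-cappedInDegree-bound {n} {d} v₀ k E loopless out≤d k<d maximal | yes avoid = begin
  sum (cappedInDegree d E) ≤⟨ sum-mono-≤ (λ y → m⊓n≤n d (inDegree E y)) ⟩
  sum (inDegree E)         ≤⟨ sum-inDegree-bound v₀ E loopless maximal avoid ⟩
  2 * k * (2 * k + 2)      ≤⟨ *-monoʳ-≤ (2 * k) k<d ⟩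
  2 * k * d                ∎
  where open ≤-Reasoning
-- The empty matching misses every vertex, so this case is void.
sum-cappedInDegree-bound v₀ zero E _ _ _ _ | no ¬avoid =
  contradiction (λ v → [] , refl , [] , []) ¬avoid
sum-cappedInDegree-bound {n} {d} v₀ (suc k) E loopless out≤d k<d maximal | no ¬avoid
  with v , v-essential ← ¬∀⟶∃¬ _ _ (λ v → hasMatching? (delete v E) (suc k)) ¬avoid = begin
  sum (cappedInDegree d E)
    -- As a head, `v` costs at most the cap `d`; as a tail, it costs at most one for each of its
    -- out-edges, again at most `d`.
    ≤⟨ sum-≤-except v (λ y y≢v → cappedInDegree-≤-except d E (delete v E) y v (λ x x≢v → delete⁺ v E x y x≢v y≢v)) ⟩
  cappedInDegree d E v + sum (λ y → ⟦ E v y ⟧ + cappedInDegree d (delete v E) y)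
    ≡⟨ cong (cappedInDegree d E v +_) (∑-distrib-+ (λ y → ⟦ E v y ⟧) (cappedInDegree d (delete v E))) ⟩
  cappedInDegree d E v + (outDegree E v + sum (cappedInDegree d (delete v E)))
    ≤⟨ +-mono-≤ (m⊓n≤m d _) (+-mono-≤ (out≤d v)
         (sum-cappedInDegree-bound v₀ k (delete v E) (delete-loopless v E loopless)
           (λ x → ≤-trans (outDegree-mono (delete v E) E x (λ y → proj₂ ∘ proj₂ ∘ delete⁻ v E x y)) (out≤d x))
           (≤-trans (+-monoˡ-≤ 2 (*-monoʳ-≤ 2 (n≤1+n k))) k<d)
           -- No matching of size `suc k` survives the deletion: this is the maximality hypothesis
           -- for `k`.
           v-essential)) ⟩
  d + (d + 2 * k * d)
    ≡⟨ expand k d ⟩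
  2 * suc k * d ∎
  where
  open ≤-Reasoning
  expand : ∀ k d → d + (d + 2 * k * d) ≡ 2 * suc k * d
  expand = solve-∀

-- Spiders and the weighted double count.

module _ {n : ℕ} where

  -- A matching in this graph is the set of outer edges of a spider centred at `r`. Only `x ≢ r` is
  -- demanded; `y ≢ r` follows from `E y r` by looplessness.
  secondEdgesTo : Fin n → (Fin n → Fin n → Bool) → Fin n → Fin n → Bool
  secondEdgesTo r E x y = not (does (x ≟ r)) ∧ E y r ∧ E x y

  secondEdgesTo⁻ : ∀ r E x y → secondEdgesTo r E x y ≡ true → x ≢ r × E y r ≡ true × E x y ≡ true
  secondEdgesTo⁻ r E x y p with x ≟ r | E y r | p
  ... | no x≢r | true  | p = x≢r , refl , p
  ... | no _   | false | ()
  ... | yes _  | _     | ()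

  secondEdgesTo⁺ : ∀ r E x y → x ≢ r → E y r ≡ true → E x y ≡ true → secondEdgesTo r E x y ≡ true
  secondEdgesTo⁺ r E x y x≢r yr xy rewrite dec-false (x ≟ r) x≢r | yr = xy

  spider : ∀ (G : Digraph n) (E : Fin n → Fin n → Bool) → (∀ x y → E x y ≡ true → Edge G x y) →
    ∀ r {ℓ} → HasMatching (secondEdgesTo r E) ℓ → HasSpider2 G ℓ
  spider G E E⇒G r (M , refl , M⊆ , M!) = record
    { r       = r
    ; xs      = xs
    ; ys      = ys
    ; xs-inj  = λ {i} {j} eq → lookup-ends-disjoint M M! i j (inj₁ refl) (inj₁ eq)
    ; ys-inj  = λ {i} {j} eq → lookup-ends-disjoint M M! i j (inj₂ refl) (inj₂ eq)
    -- A common vertex forces `i ≡ j`, and then the edge from `xs i` to `ys i` would be a loop.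
    ; xs≢ys   = λ i j eq → case lookup-ends-disjoint M M! i j (inj₁ refl) (inj₂ eq) of λ where
        refl → irreflexive (edge-xy i) eq
    ; xs≢r    = λ i → proj₁ (edges i)
    ; ys≢r    = λ i → irreflexive (edge-yr i)
    ; edge-xy = edge-xy
    ; edge-yr = edge-yr
    }
    where
    xs ys : Fin (length M) → Fin n
    xs i = proj₁ (lookup M i)
    ys i = proj₂ (lookup M i)

    edges : ∀ i → xs i ≢ r × E (ys i) r ≡ true × E (xs i) (ys i) ≡ true
    edges i = secondEdgesTo⁻ r E (xs i) (ys i) (All.lookup M⊆ (∈-lookup i))

    edge-xy : ∀ i → Edge G (xs i) (ys i)
    edge-xy i = E⇒G _ _ (proj₂ (proj₂ (edges i)))

    edge-yr : ∀ i → Edge G (ys i) r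
    edge-yr i = E⇒G _ _ (proj₁ (proj₂ (edges i)))

    irreflexive : ∀ {x y} → Edge G x y → x ≢ y
    irreflexive xx refl with () ← trans (sym xx) (noLoop G _)

  sum-inDegree≡sum-outDegree : ∀ (E : Fin n → Fin n → Bool) → sum (inDegree E) ≡ sum (outDegree E)
  sum-inDegree≡sum-outDegree E = ∑-comm (λ y x → ⟦ E x y ⟧)

  -- After exchanging the sums, each `y` contributes `f y` once for each of its `d` out-edges.
  sum-inNbhds : ∀ (E : Fin n → Fin n → Bool) d → (∀ x → outDegree E x ≡ d) → (f : Fin n → ℕ) →
    sum (λ r → sum (λ y → ⟦ E y r ⟧ * f y)) ≡ sum (λ r → d * f r)
  sum-inNbhds E d out≡d f = trans (∑-comm (λ r y → ⟦ E y r ⟧ * f y)) (sum-cong-≗ λ y →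
    trans (sym (*-distribʳ-sum (f y) (λ r → ⟦ E y r ⟧))) (cong (_* f y) (out≡d y)))

  -- Each in-neighbour weighs at most `d`, and below the cap the weight of `r` is its in-degree.
  inNbhd-bound-low : ∀ (E : Fin n → Fin n → Bool) {d r} → inDegree E r ≤ d →
    sum (λ y → ⟦ E y r ⟧ * cappedInDegree d E y) ≤ d * cappedInDegree d E r
  inNbhd-bound-low E {d} {r} in≤d = begin
    sum (λ y → ⟦ E y r ⟧ * cappedInDegree d E y)
      ≤⟨ sum-mono-≤ (λ y → *-monoʳ-≤ ⟦ E y r ⟧ (m⊓n≤m d (inDegree E y))) ⟩
    sum (λ y → ⟦ E y r ⟧ * d)  ≡⟨ *-distribʳ-sum d (λ y → ⟦ E y r ⟧) ⟨
    inDegree E r * d           ≡⟨ *-comm (inDegree E r) d ⟩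
    d * inDegree E r           ≡⟨ cong (d *_) (m≥n⇒m⊓n≡n in≤d) ⟨
    d * cappedInDegree d E r   ∎
    where open ≤-Reasoning

  inNbhd-bound-high : ∀ (E : Fin n → Fin n → Bool) → (∀ x → E x x ≡ false) → ∀ k → (∀ x → outDegree E x ≤ 2 * suc k) →
    ∀ r → ¬ HasMatching (secondEdgesTo r E) (suc k) → 2 * suc k ≤ inDegree E r →
    sum (λ y → ⟦ E y r ⟧ * cappedInDegree (2 * suc k) E y) < 2 * suc k * cappedInDegree (2 * suc k) E r
  inNbhd-bound-high E loopless k out≤d r maximal d≤in = begin-strict
    sum (λ y → ⟦ E y r ⟧ * cappedInDegree d E y)          ≤⟨ sum-mono-≤ pointwise ⟩
    sum (λ y → ⟦ E r y ⟧ + cappedInDegree d F y)          ≡⟨ ∑-distrib-+ (λ y → ⟦ E r y ⟧) (cappedInDegree d F) ⟩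
    outDegree E r + sum (cappedInDegree d F)              ≤⟨ +-mono-≤ (out≤d r) F-bound ⟩
    -- Strictness arises here: `suc (2 * k)` is one less than `d`.
    suc (2 * k) * d                                       <⟨ *-monoˡ-< d (≤-reflexive (sym (*-suc 2 k))) ⟩
    d * d                                                 ≡⟨ cong (d *_) (m≤n⇒m⊓n≡m d≤in) ⟨
    d * cappedInDegree d E r                              ∎
    where
    open ≤-Reasoning
    d = 2 * suc k
    F = secondEdgesTo r E

    pointwise : ∀ y → ⟦ E y r ⟧ * cappedInDegree d E y ≤ ⟦ E r y ⟧ + cappedInDegree d F y
    pointwise y = from-neighbour (E y r) refl
      where
      from-neighbour : ∀ b → E y r ≡ b → ⟦ b ⟧ * cappedInDegree d E y ≤ ⟦ E r y ⟧ + cappedInDegree d F y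
      from-neighbour false _  = z≤n
      -- At an in-neighbour `y` of `r`, the only edge into `y` that `F` can lose is the one from
      -- `r`.
      from-neighbour true  yr = ≤-trans (≤-reflexive (*-identityˡ _))
        (cappedInDegree-≤-except d E F y r λ x x≢r → secondEdgesTo⁺ r E x y x≢r yr)

    F-bound : sum (cappedInDegree d F) ≤ 2 * k * d
    F-bound = sum-cappedInDegree-bound r k F
      (λ x → Bool.¬-not λ xx → case trans (sym (proj₂ (proj₂ (secondEdgesTo⁻ r E x x xx)))) (loopless x) of λ ())
      (λ x → ≤-trans (outDegree-mono F E x (λ y → proj₂ ∘ proj₂ ∘ secondEdgesTo⁻ r E x y)) (out≤d x))
      -- The condition `2 * k + 2 ≤ d` holds with equality.
      (≤-reflexive (trans (+-comm (2 * k) 2) (sym (*-suc 2 k))))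
      maximal

∃-matching : ∀ {n} → Fin n → (E : Fin n → Fin n → Bool) → (∀ x → E x x ≡ false) → ∀ k →
  (∀ x → outDegree E x ≡ 2 * suc k) → ∃[ r ] HasMatching (secondEdgesTo r E) (suc k)
∃-matching {n} v₀ E loopless k out≡d
  with any? (λ r → hasMatching? (secondEdgesTo r E) (suc k)) | any? (λ r → 2 * suc k ≤? inDegree E r)
... | yes found   | _ = found
-- All in-degrees would be below `d` and all out-degrees equal to it, yet both sum to the number of
-- edges.
... | no _        | no all-low = contradiction
  (sum-mono-< {f = inDegree E} {outDegree E} (λ r → <⇒≤ (in<out r)) v₀ (in<out v₀))
  (<-irrefl (sum-inDegree≡sum-outDegree E))
  where
  in<out : ∀ r → inDegree E r < outDegree E r
  in<out r = subst (inDegree E r <_) (sym (out≡d r)) (≰⇒> λ d≤in → all-low (r , d≤in))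
-- Summed over `r`, the bounds contradict the double count, as `r₀` makes one of them strict.
... | no none | yes (r₀ , r₀-high) = contradiction
  (sum-mono-< {f = λ r → sum (λ y → ⟦ E y r ⟧ * cappedInDegree (2 * suc k) E y)}
    bound r₀ (strict-bound r₀ r₀-high))
  (<-irrefl (sum-inNbhds E (2 * suc k) out≡d (cappedInDegree (2 * suc k) E)))
  where
  strict-bound : ∀ r → 2 * suc k ≤ inDegree E r →
    sum (λ y → ⟦ E y r ⟧ * cappedInDegree (2 * suc k) E y) < 2 * suc k * cappedInDegree (2 * suc k) E r
  strict-bound r = inNbhd-bound-high E loopless k (≤-reflexive ∘ out≡d) r (λ m → none (r , m))

  bound : ∀ r →
    sum (λ y → ⟦ E y r ⟧ * cappedInDegree (2 * suc k) E y) ≤ 2 * suc k * cappedInDegree (2 * suc k) E r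
  bound r with ≤-total (inDegree E r) (2 * suc k)
  ... | inj₁ in≤d = inNbhd-bound-low E in≤d
  ... | inj₂ d≤in = <⇒≤ (strict-bound r d≤in)

theorem1p2 : (ℓ : ℕ) → 1 ≤ ℓ → (n : ℕ) → (G : Digraph (suc n)) →
    (∀ (v : Fin (suc n)) → 2 * ℓ ≤ outDeg G v) → HasSpider2 G ℓ
theorem1p2 (suc k) _ n G deg =
  -- Averaging needs a vertex; `Fin (suc n)` supplies `zero`.
  let r , M = ∃-matching zero E loopless k (λ x → proj₂ (proj₂ (trimmed x)))
  in spider G E (λ x → proj₁ (proj₂ (trimmed x))) r M
  where
  trimmed : ∀ x → ∃[ q ] (∀ y → q y ≡ true → adj G x y ≡ true) × sum (λ y → ⟦ q y ⟧) ≡ 2 * suc k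
  trimmed x = ∃-trim (2 * suc k) (adj G x) (subst (2 * suc k ≤_) (∣tabulate∣≡sum (adj G x)) (deg x))

  E : Fin (suc n) → Fin (suc n) → Bool
  E x = proj₁ (trimmed x)

  loopless : ∀ x → E x x ≡ false
  loopless x = Bool.¬-not λ xx → case trans (sym (proj₁ (proj₂ (trimmed x)) x xx)) (noLoop G x) of λ ()
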